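{- The categories $\mathsf{SLataSp}$ (SLata-spaces and SLata-relations) and $\mathsf{RelSP}$ (RelS-spaces and adjoint-preserving relations) are isomorphic.
   Context: **S-spaces.** Let $X$ be a set and $\mathcal{K}\subseteq\mathcal{P}(X)$, regarded as a subbase of a topology on $X$. Put $S(X)=\{U^c: U\in\mathcal{K}\}$ and $\mathcal{C}_{\mathcal{K}}(X)=\{\bigcap\mathcal{A}:\mathcal{A}\subseteq S(X)\}$. For $Y\subseteq X$, a family $\mathcal{J}\subseteq S(X)$ is a $Y$-family if for all $A,B\in\mathcal{J}$ there are $H\in S(X)$, $C\in\mathcal{J}$ with $Y\subseteq H$, $A\cap H\subseteq C$ and $B\cap H\subseteq C$. $\langle X,\mathcal{K}\rangle$ is an S-space if: (S1) the topology is $T_0$ and $X=\bigcup\mathcal{K}$; (S2) $\mathcal{K}$ is a subbase of compact open sets, closed under finite unions, and $\emptyset\in\mathcal{K}$; (S3) if $x\in U\cap V$ with $U,V\in\mathcal{K}$, there are $W,D\in\mathcal{K}$ with $x\notin W$, $x\in D$, $D\subseteq(U\cap V)\cup W$; (S4) if $Y\in\mathcal{C}_{\mathcal{K}}(X)$ and $\mathcal{J}\subseteq S(X)$ is a $Y$-family with $Y\cap A^c\neq\emptyset$ for all $A\in\mathcal{J}$, then $Y\cap\bigcap\{A^c:A\in\mathcal{J}\}\neq\emptyset$. Put $\mathrm{cl}_{\mathcal{K}}(x)=\bigcap\{U\in S(X):x\in U\}$. The dual specialization order is: $x\sqsupseteq_X y$ iff $y\in\mathrm{cl}_{\mathcal{K}}(x)$;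 relative to it, $\uparrow x=\mathrm{cl}_{\mathcal{K}}(x)$. **Meet-relations.** For a relation $T\subseteq X\times Y$ write $T(x)=\{y:(x,y)\in T\}$ and $\Box_T(U)=\{x\in X:T(x)\subseteq U\}$. A meet-relation between S-spaces $\langle X_1,\mathcal{K}_1\rangle$ and $\langle X_2,\mathcal{K}_2\rangle$ is $T\subseteq X_1\times X_2$ such that $\Box_T(U)\in S(X_1)$ for all $U\in S(X_2)$, and $T(x)=\bigcap\{U\in S(X_2):T(x)\subseteq U\}$ for all $x\in X_1$. For relations $R\subseteq X_1\times X_2$, $T\subseteq X_2\times X_3$ between S-spaces, put $T*R=\{(x,z)\in X_1\times X_3:\forall U\in S(X_3)\,((T\circ R)(x)\subseteq U\Rightarrow z\in U)\}$, where $(T\circ R)(x)=\bigcup_{y\in R(x)}T(y)$. **mS-spaces.** $\mathcal{Z}(X)$ is the set of all $Z=\bigcap\mathcal{L}$ with $\mathcal{L}\subseteq\mathcal{K}$ non-empty and dually directed under $\subseteq$ (any two members of $\mathcal{L}$ contain a common member of $\mathcal{L}$). For $U\in S(X)$, $L_U=\{Z\in\mathcal{Z}(X):Z\cap U\neq\emptyset\}$. An mS-space is $\langle X,\mathcal{K},R\rangle$ with $\langle X,\mathcal{K}\rangle$ an S-space and $R\subseteq X\times\mathcal{Z}(X)$ such that, with $R(x)=\{Z:(x,Z)\in R\}$ and $m_R(U)=\{x\in X:R(x)\subseteq L_U\}$: (m1) $m_R(U)\in S(X)$ for all $U\in S(X)$; (m2) $R(x)=\bigcap\{L_U:U\in S(X),\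 x\in m_R(U)\}$ for all $x\in X$. A meet-relation $T\subseteq X_1\times X_2$ between mS-spaces $\langle X_j,\mathcal{K}_j,R_j\rangle$ is monotone if $\Box_T\circ m_{R_2}=m_{R_1}\circ\Box_T$ on $S(X_2)$. **$\mathsf{SLataSp}$.** An SLata-space is $\langle X,\mathcal{K},I,E\rangle$ such that: (A1) $\langle X,\mathcal{K},I\rangle$ and $\langle X,\mathcal{K},E\rangle$ are mS-spaces; (A2) for every $U\in S(X)$, if $x\in U$ then for every $Z\in E(x)$ there is $w\in Z$ with $I(w)\subseteq L_U$; (A3) for every $U\in S(X)$, if for every $Z\in I(x)$ there is $y\in Z$ with $E(y)\subseteq L_U$, then $x\in U$. An SLata-relation between SLata-spaces is a meet-relation that is monotone with respect to both the $I$'s and the $E$'s. $\mathsf{SLataSp}$ has SLata-spaces as objects, SLata-relations as morphisms, composition $*$, and identities $\sqsupseteq_X$. **$\mathsf{RelSP}$.** For an S-space and $U\in S(X)$ let $D_U=\{Y\in\mathcal{C}_{\mathcal{K}}(X):Y\subseteq U\}$. A relation $T\subseteq X\times X$ on an S-space $\langle X,\mathcal{K}\rangle$ is an A-relation if: (1) $\Box_T(U)\in S(X)$ for every $U\in S(X)$; (2) for all $U\in S(X)$, $\bigcap F_U^T\in S(X)$, where $F_U^T=\{V\in S(X):U\subseteq\Box_T(V)\}$. A RelS-space is $\langle X,\mathcal{K},T\rangle$ where $\langle X,\mathcal{K}\rangle$ is an S-space and $T\subseteq X\times X$ is an A-relation. Given RelS-spaces $\langle X,\mathcal{K}_X,T_X\rangle$,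 $\langle Y,\mathcal{K}_Y,T_Y\rangle$, a relation $M\subseteq X\times Y$ is adjoint-preserving if: (1) $M$ is a meet-relation; (2) $M*T_X=T_Y*M$; (3) for every $x\in X$, $U\in S(X)$ and $V\in S(Y)$: $(M(x)\in D_V\Rightarrow T_X(x)\in D_U)\Rightarrow(M(x)\in\bigcap_{W\in F_V^{T_Y}}D_W\Rightarrow\ \uparrow x\in D_U)$. $\mathsf{RelSP}$ has RelS-spaces as objects, adjoint-preserving relations as morphisms, composition $*$, and identities $\sqsupseteq_X$.
   Formalization: Y-families in (S4) are taken non-empty (else no S-space exists); in (3) each of the two inner implications is quantified over all x separately (else identities fail); A-relations must have T(x) in C_K(X) (else composition can fail). -}

module Defs where

open import Level using (Level; suc; _⊔_)
open import Data.List.Base using (List)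
open import Data.List.Relation.Unary.All using (All)
open import Data.List.Relation.Unary.Any using (Any)
open import Data.Product.Base using (∃-syntax; Σ-syntax; _×_; _,_; proj₁; proj₂)
open import Data.Sum.Base using (_⊎_)
open import Function.Base using (id; _∘_)
open import Relation.Binary.Core using (Rel; REL; _⇔_)
open import Relation.Binary.Definitions using (Reflexive; Symmetric; Transitive)
open import Relation.Binary.PropositionalEquality.Core
  using (_≡_; _≢_; refl; sym; trans; subst; subst₂)
open import Relation.Unary
  using (Pred; _∈_; _∉_; _⊆_; _≐_; _∩_; _∪_; ∁; _≬_; Satisfiable)
open import Relation.Unary.Polymorphic using (∅)
open import Relation.Unary.Properties using (≐-refl; ≐-sym; ≐-trans)

private
  variable
    a b ℓ : Level

------------------------------------------------------------------------
-- Subsets, families of subsets and relations.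
--
-- A subset of X : Set ℓ is a predicate in Set ℓ, and subsets are equal when
-- they have the same elements (_≐_).  Sets defined by quantifying over all
-- subsets, such as cl x or T * R, live one universe higher; this is why
-- relations do so too, and why _≐_ and the operators below accept
-- predicates of any level.  Under excluded middle every predicate is _≐_ to
-- one in Set ℓ, so the levels carry no mathematical content.

𝒫 : Set ℓ → Set (suc ℓ)
𝒫 {ℓ} X = Pred X ℓ

Family : Set ℓ → Set (suc (suc ℓ))
Family {ℓ} X = Pred (𝒫 X) (suc ℓ)

Relation : Set ℓ → Set ℓ → Set (suc (suc ℓ))
Relation {ℓ} X Y = REL X Y (suc ℓ)

MultiRelation : Set ℓ → Set (suc (suc ℓ))
MultiRelation {ℓ} X = REL X (𝒫 X) (suc ℓ)

⋂ : {X : Set ℓ} → Pred (𝒫 X) b → Pred X (suc ℓ ⊔ b)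
⋂ {X = X} 𝒜 x = (U : 𝒫 X) → U ∈ 𝒜 → x ∈ U

------------------------------------------------------------------------

module _ {X : Set ℓ} (𝒦 : Family X) where

  IsOpen : Pred (𝒫 X) (suc ℓ)
  IsOpen O = ∀ {x} → x ∈ O → ∃[ Us ]
    All (_∈ 𝒦) Us × All (x ∈_) Us × (∀ {y} → All (y ∈_) Us → y ∈ O)

  IsCompact : Pred (𝒫 X) (suc (suc ℓ))
  IsCompact O = (𝒰 : Family X) → 𝒰 ⊆ IsOpen →
    (∀ {x} → x ∈ O → ∃[ U ] U ∈ 𝒰 × x ∈ U) →
    ∃[ Us ] All (_∈ 𝒰) Us × (∀ {x} → x ∈ O → Any (x ∈_) Us)

  IsT₀ : Set (suc ℓ)
  IsT₀ = ∀ {x y} → x ≢ y →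
    ∃[ O ] IsOpen O × ((x ∈ O × y ∉ O) ⊎ (x ∉ O × y ∈ O))

------------------------------------------------------------------------

  S : Pred (Pred X a) (suc ℓ ⊔ a)
  S A = Σ[ U ∈ 𝒫 X ] U ∈ 𝒦 × A ≐ ∁ U

  𝒞 : Pred (Pred X a) (suc (suc ℓ) ⊔ a)
  𝒞 Y = Σ[ 𝒜 ∈ Family X ] 𝒜 ⊆ S × Y ≐ ⋂ 𝒜

  IsYFamily : 𝒫 X → Pred (Family X) (suc ℓ)
  IsYFamily Y 𝒥 = ∀ {A B} → A ∈ 𝒥 → B ∈ 𝒥 →
    Σ[ H ∈ 𝒫 X ] ∃[ C ] H ∈ S × C ∈ 𝒥 × Y ⊆ H × A ∩ H ⊆ C × B ∩ H ⊆ C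

  cl : Relation X X
  cl x = ⋂ (λ U → U ∈ S × x ∈ U)

  -- 𝒥 is non-empty in S4: for empty 𝒥 the axiom would say that every member
  -- of 𝒞 is inhabited, whereas ⋂ S ∈ 𝒞 is empty by S1-cover.
  record IsSSpace : Set (suc (suc ℓ)) where
    field
      -- 𝒦 is a set of subsets, hence closed under equality of subsets
      𝒦-resp   : ∀ {U V} → U ≐ V → U ∈ 𝒦 → V ∈ 𝒦
      S1-T₀    : IsT₀
      S1-cover : ∀ x → ∃[ U ] U ∈ 𝒦 × x ∈ U
      S2-compact : ∀ {U} → U ∈ 𝒦 → IsCompact U
      S2-∪     : ∀ {U V} → U ∈ 𝒦 → V ∈ 𝒦 → (U ∪ V) ∈ 𝒦
      S2-∅     : ∅ ∈ 𝒦
      S3       : ∀ {x U V} → U ∈ 𝒦 → V ∈ 𝒦 → x ∈ U ∩ V →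
                 ∃[ W ] ∃[ D ] W ∈ 𝒦 × D ∈ 𝒦 × x ∉ W × x ∈ D × D ⊆ (U ∩ V) ∪ W
      S4       : ∀ {Y} → Y ∈ 𝒞 → ∀ {𝒥 : Family X} → Satisfiable 𝒥 → 𝒥 ⊆ S →
                 IsYFamily Y 𝒥 → (∀ {A} → A ∈ 𝒥 → Y ≬ ∁ A) →
                 ∃[ y ] y ∈ Y × (∀ {A} → A ∈ 𝒥 → y ∈ ∁ A)

------------------------------------------------------------------------

□ : {X Y : Set ℓ} → Relation X Y → Pred Y a → Pred X (suc ℓ ⊔ a)
□ T U x = T x ⊆ U

record IsMeetRelation {X₁ X₂ : Set ℓ} (𝒦₁ : Family X₁) (𝒦₂ : Family X₂)
                      (T : Relation X₁ X₂) : Set (suc (suc ℓ)) where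
  field
    □-S    : ∀ {U : 𝒫 X₂} → U ∈ S 𝒦₂ → □ T U ∈ S 𝒦₁
    closed : ∀ x → T x ≐ ⋂ (λ U → U ∈ S 𝒦₂ × T x ⊆ U)

_∘ᴿ_ : {X₁ X₂ X₃ : Set ℓ} → Relation X₂ X₃ → Relation X₁ X₂ → Relation X₁ X₃
(T ∘ᴿ R) x z = ∃[ y ] R x y × T y z

-- comp 𝒦₃ T R is T * R.
comp : {X₁ X₂ X₃ : Set ℓ} → Family X₃ →
       Relation X₂ X₃ → Relation X₁ X₂ → Relation X₁ X₃
comp {X₃ = X₃} 𝒦₃ T R x z =
  (U : 𝒫 X₃) → U ∈ S 𝒦₃ → (T ∘ᴿ R) x ⊆ U → z ∈ U

------------------------------------------------------------------------

module _ {X : Set ℓ} (𝒦 : Family X) where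

  𝒵 : Pred (𝒫 X) (suc (suc ℓ))
  𝒵 Z = Σ[ ℒ ∈ Family X ] ℒ ⊆ 𝒦 × Satisfiable ℒ ×
    (∀ {A B} → A ∈ ℒ → B ∈ ℒ → ∃[ C ] C ∈ ℒ × C ⊆ A × C ⊆ B) ×
    Z ≐ ⋂ ℒ

  L : Pred X a → Pred (𝒫 X) (suc (suc ℓ) ⊔ a)
  L U Z = Z ∈ 𝒵 × Z ≬ U

  m : MultiRelation X → Pred X a → Pred X (suc (suc ℓ) ⊔ a)
  m R U x = R x ⊆ L U

  -- The intersection in m2 is taken inside 𝒵.
  record IsMSSpace (R : MultiRelation X) : Set (suc (suc ℓ)) where
    field
      isSSpace : IsSSpace 𝒦
      R⊆𝒵      : ∀ x → R x ⊆ 𝒵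
      m1       : ∀ {U : 𝒫 X} → U ∈ S 𝒦 → m R U ∈ S 𝒦
      m2       : ∀ x → R x ≐
                 (λ Z → Z ∈ 𝒵 × ((U : 𝒫 X) → U ∈ S 𝒦 → x ∈ m R U → Z ∈ L U))

IsMonotone : {X₁ X₂ : Set ℓ} → (𝒦₁ : Family X₁) → MultiRelation X₁ →
             (𝒦₂ : Family X₂) → MultiRelation X₂ →
             Relation X₁ X₂ → Set (suc (suc ℓ))
IsMonotone {X₂ = X₂} 𝒦₁ R₁ 𝒦₂ R₂ T =
  ∀ {U : 𝒫 X₂} → U ∈ S 𝒦₂ → □ T (m 𝒦₂ R₂ U) ≐ m 𝒦₁ R₁ (□ T U)

------------------------------------------------------------------------

record SLataSpace (ℓ : Level) : Set (suc (suc ℓ)) where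
  field
    {Carrier} : Set ℓ
    𝒦  : Family Carrier
    I  : MultiRelation Carrier
    E  : MultiRelation Carrier
    A1-I : IsMSSpace 𝒦 I
    A1-E : IsMSSpace 𝒦 E
    A2 : ∀ {U : 𝒫 Carrier} → U ∈ S 𝒦 → ∀ {x} → x ∈ U →
         ∀ {Z} → Z ∈ E x → ∃[ w ] w ∈ Z × I w ⊆ L 𝒦 U
    A3 : ∀ {U : 𝒫 Carrier} → U ∈ S 𝒦 → ∀ {x} →
         (∀ {Z} → Z ∈ I x → ∃[ y ] y ∈ Z × E y ⊆ L 𝒦 U) → x ∈ U

record IsSLataRelation (A B : SLataSpace ℓ)
    (M : Relation (SLataSpace.Carrier A) (SLataSpace.Carrier B)) :
    Set (suc (suc ℓ)) where
  private
    module A = SLataSpace A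
    module B = SLataSpace B
  field
    isMeetRelation : IsMeetRelation A.𝒦 B.𝒦 M
    monotone-I     : IsMonotone A.𝒦 A.I B.𝒦 B.I M
    monotone-E     : IsMonotone A.𝒦 A.E B.𝒦 B.E M

------------------------------------------------------------------------

module _ {X : Set ℓ} (𝒦 : Family X) where

  D : Pred X a → Pred (Pred X b) (suc (suc ℓ) ⊔ a ⊔ b)
  D U Y = Y ∈ 𝒞 𝒦 × Y ⊆ U

  F : Relation X X → Pred X a → Pred (𝒫 X) (suc ℓ ⊔ a)
  F T U V = V ∈ S 𝒦 × U ⊆ □ T V

  -- T takes values in 𝒞: membership T x ∈ D U, in the definition of
  -- adjoint-preserving relations, presupposes it.  Without T∈𝒞 the relation
  -- T would not be determined by □ T (e.g. _≡_ and cl have the same □ on S).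
  record IsARelation (T : Relation X X) : Set (suc (suc ℓ)) where
    field
      T∈𝒞  : ∀ x → T x ∈ 𝒞 𝒦
      □-S  : ∀ {U : 𝒫 X} → U ∈ S 𝒦 → □ T U ∈ S 𝒦
      ⋂F-S : ∀ {U : 𝒫 X} → U ∈ S 𝒦 → ⋂ (F T U) ∈ S 𝒦

record RelSSpace (ℓ : Level) : Set (suc (suc ℓ)) where
  field
    {Carrier}   : Set ℓ
    𝒦           : Family Carrier
    T           : Relation Carrier Carrier
    isSSpace    : IsSSpace 𝒦
    isARelation : IsARelation 𝒦 T

-- In `adjoint` each of the two implications is a statement about all points:
-- for h = □ M and i the left adjoint V ↦ ⋂ (F T V) of □ T, it says that
-- h V ⊆ □ T U implies h (i V) ⊆ U.  With one x shared by both implications,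
-- identities would fail to be adjoint-preserving: take the discrete space
-- {p , q} with T x = {the other point}, U = ∅, V = {q} and x = p.
record IsAdjointPreserving (A B : RelSSpace ℓ)
    (M : Relation (RelSSpace.Carrier A) (RelSSpace.Carrier B)) :
    Set (suc (suc ℓ)) where
  private
    module A = RelSSpace A
    module B = RelSSpace B
  field
    isMeetRelation : IsMeetRelation A.𝒦 B.𝒦 M
    commutes : comp B.𝒦 M A.T ⇔ comp B.𝒦 B.T M
    adjoint  : ∀ {U : 𝒫 A.Carrier} {V : 𝒫 B.Carrier} → U ∈ S A.𝒦 → V ∈ S B.𝒦 →
      (∀ x → M x ∈ D B.𝒦 V → A.T x ∈ D A.𝒦 U) →
      (∀ x → (∀ {W} → W ∈ F B.𝒦 B.T V → M x ∈ D B.𝒦 W) → cl A.𝒦 x ∈ D A.𝒦 U)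

------------------------------------------------------------------------
-- Categories with equality of objects, and their isomorphisms.
--
-- Equality of arrows relates arrows with arbitrary end points, as it does
-- for arrows regarded as elements of one class; equal arrows have equal
-- domains and codomains.

record Category (o h e : Level) : Set (suc (o ⊔ h ⊔ e)) where
  infix  4 _≋_ _≈_
  infixr 9 _⊚_
  field
    Obj : Set o
    Hom : Obj → Obj → Set h
    _≋_ : Rel Obj e
    _≈_ : ∀ {A B A′ B′} → REL (Hom A B) (Hom A′ B′) e
    Id  : ∀ A → Hom A A
    _⊚_ : ∀ {A B C} → Hom B C → Hom A B → Hom A C

    ≋-refl  : Reflexive _≋_
    ≋-sym   : Symmetric _≋_
    ≋-trans : Transitive _≋_

    ≈-refl  : ∀ {A B} {f : Hom A B} → f ≈ f
    ≈-sym   : ∀ {A B A′ B′} {f : Hom A B} {g : Hom A′ B′} → f ≈ g → g ≈ f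
    ≈-trans : ∀ {A B A′ B′ A″ B″}
              {f : Hom A B} {g : Hom A′ B′} {h : Hom A″ B″} →
              f ≈ g → g ≈ h → f ≈ h
    ≈-dom   : ∀ {A B A′ B′} {f : Hom A B} {g : Hom A′ B′} → f ≈ g → A ≋ A′
    ≈-cod   : ∀ {A B A′ B′} {f : Hom A B} {g : Hom A′ B′} → f ≈ g → B ≋ B′

    Id-cong : ∀ {A A′} → A ≋ A′ → Id A ≈ Id A′
    ⊚-cong  : ∀ {A B C A′ B′ C′} {f : Hom A B} {f′ : Hom A′ B′}
              {g : Hom B C} {g′ : Hom B′ C′} →
              g ≈ g′ → f ≈ f′ → (g ⊚ f) ≈ (g′ ⊚ f′)

    identityˡ : ∀ {A B} {f : Hom A B} → (Id B ⊚ f) ≈ f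
    identityʳ : ∀ {A B} {f : Hom A B} → (f ⊚ Id A) ≈ f
    assoc     : ∀ {A B C D} {f : Hom A B} {g : Hom B C} {h : Hom C D} →
                ((h ⊚ g) ⊚ f) ≈ (h ⊚ (g ⊚ f))

record Functor {o h e o′ h′ e′} (𝐂 : Category o h e) (𝐃 : Category o′ h′ e′) :
    Set (o ⊔ h ⊔ e ⊔ o′ ⊔ h′ ⊔ e′) where
  private
    module C = Category 𝐂
    module D = Category 𝐃
  field
    F₀ : C.Obj → D.Obj
    F₁ : ∀ {A B} → C.Hom A B → D.Hom (F₀ A) (F₀ B)
    F₀-cong  : ∀ {A B} → A C.≋ B → F₀ A D.≋ F₀ B
    F₁-cong  : ∀ {A B A′ B′} {f : C.Hom A B} {g : C.Hom A′ B′} →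
               f C.≈ g → F₁ f D.≈ F₁ g
    identity : ∀ {A} → F₁ (C.Id A) D.≈ D.Id (F₀ A)
    homomorphism : ∀ {A B C} {f : C.Hom A B} {g : C.Hom B C} →
                   F₁ (g C.⊚ f) D.≈ (F₁ g D.⊚ F₁ f)

infix 4 _≅_

record _≅_ {o h e o′ h′ e′} (𝐂 : Category o h e) (𝐃 : Category o′ h′ e′) :
    Set (o ⊔ h ⊔ e ⊔ o′ ⊔ h′ ⊔ e′) where
  private
    module C = Category 𝐂
    module D = Category 𝐃
  field
    to   : Functor 𝐂 𝐃
    from : Functor 𝐃 𝐂
  private
    module To   = Functor to
    module From = Functor from
  field
    from∘to₀ : ∀ A → From.F₀ (To.F₀ A) C.≋ A
    from∘to₁ : ∀ {A B} (f : C.Hom A B) → From.F₁ (To.F₁ f) C.≈ f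
    to∘from₀ : ∀ A → To.F₀ (From.F₀ A) D.≋ A
    to∘from₁ : ∀ {A B} (f : D.Hom A B) → To.F₁ (From.F₁ f) D.≈ f

------------------------------------------------------------------------

module _ {X : Set ℓ} (𝒦 : Family X) where

  S-resp : {A : Pred X a} {B : Pred X b} → A ≐ B → A ∈ S 𝒦 → B ∈ S 𝒦
  S-resp A≐B (U , U∈𝒦 , A≐) = U , U∈𝒦 , ≐-trans (≐-sym A≐B) A≐

  S-small : {A : Pred X a} → A ∈ S 𝒦 → Σ[ U ∈ 𝒫 X ] U ∈ S 𝒦 × A ≐ U
  S-small (U , U∈𝒦 , A≐) = ∁ U , (U , U∈𝒦 , ≐-refl) , A≐

  cl-refl : ∀ {x} → cl 𝒦 x x
  cl-refl U (_ , x∈U) = x∈U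

  cl-⊆ : {A : Pred X a} → A ∈ S 𝒦 → ∀ {x} → x ∈ A → cl 𝒦 x ⊆ A
  cl-⊆ A∈S x∈A y∈cl =
    let U , U∈S , A≐U = S-small A∈S
    in proj₂ A≐U (y∈cl U (U∈S , proj₁ A≐U x∈A))

  □-cl : {A : Pred X a} → A ∈ S 𝒦 → □ (cl 𝒦) A ≐ A
  □-cl A∈S = (λ cl⊆A → cl⊆A cl-refl) , cl-⊆ A∈S

  ⋂-∈𝒞 : {Y : Pred X a} → {𝒜 : Family X} → 𝒜 ⊆ S 𝒦 → Y ≐ ⋂ 𝒜 → Y ∈ 𝒞 𝒦
  ⋂-∈𝒞 {𝒜 = 𝒜} 𝒜⊆S eq = 𝒜 , 𝒜⊆S , eq

  cl-∈𝒞 : ∀ x → cl 𝒦 x ∈ 𝒞 𝒦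
  cl-∈𝒞 x = ⋂-∈𝒞 proj₁ ≐-refl

□-mono : {X Y : Set ℓ} (T : Relation X Y) {A : Pred Y a} {B : Pred Y b} →
         A ⊆ B → □ T A ⊆ □ T B
□-mono T A⊆B Tx⊆A = A⊆B ∘ Tx⊆A

□-cong : {X Y : Set ℓ} (T : Relation X Y) {A : Pred Y a} {B : Pred Y b} →
         A ≐ B → □ T A ≐ □ T B
□-cong T (A⊆B , B⊆A) = □-mono T A⊆B , □-mono T B⊆A

□-S′ : {X₁ X₂ : Set ℓ} {𝒦₁ : Family X₁} {𝒦₂ : Family X₂} {T : Relation X₁ X₂} →
       (∀ {U : 𝒫 X₂} → U ∈ S 𝒦₂ → □ T U ∈ S 𝒦₁) →
       {A : Pred X₂ a} → A ∈ S 𝒦₂ → □ T A ∈ S 𝒦₁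
□-S′ {𝒦₁ = 𝒦₁} {𝒦₂ = 𝒦₂} {T = T} □-S A∈S =
  let U , U∈S , A≐U = S-small 𝒦₂ A∈S
  in S-resp 𝒦₁ (□-cong T (≐-sym A≐U)) (□-S U∈S)

module _ {X₁ X₃ : Set ℓ} (𝒦₃ : Family X₃) where

  □-comp : {X₂ : Set ℓ} (T : Relation X₂ X₃) (R : Relation X₁ X₂) {A : Pred X₃ a} →
           A ∈ S 𝒦₃ → □ (comp 𝒦₃ T R) A ≐ □ R (□ T A)
  □-comp T R A∈S =
    let U , U∈S , A≐U = S-small 𝒦₃ A∈S
    in (λ sub {y} Rxy {z} Tyz → sub (λ V V∈S RT⊆V → RT⊆V (y , Rxy , Tyz))) ,
       (λ sub {z} z∈ → proj₂ A≐U (z∈ U U∈S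
          (λ (y , Rxy , Tyz) → proj₁ A≐U (sub Rxy Tyz))))

  comp-⇒ : {X₂ X₂′ : Set ℓ} {T : Relation X₂ X₃} {R : Relation X₁ X₂}
           {T′ : Relation X₂′ X₃} {R′ : Relation X₁ X₂′} →
           (∀ {U : 𝒫 X₃} → U ∈ S 𝒦₃ → □ R′ (□ T′ U) ⊆ □ R (□ T U)) →
           ∀ {x z} → comp 𝒦₃ T R x z → comp 𝒦₃ T′ R′ x z
  comp-⇒ sub z∈ U U∈S RT′⊆U =
    z∈ U U∈S (λ (y , Rxy , Tyz) →
      sub U∈S (λ R′xy T′yz → RT′⊆U (_ , R′xy , T′yz)) Rxy Tyz)

  comp-⇔ : {X₂ X₂′ : Set ℓ} {T : Relation X₂ X₃} {R : Relation X₁ X₂}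
           {T′ : Relation X₂′ X₃} {R′ : Relation X₁ X₂′} →
           (∀ {U : 𝒫 X₃} → U ∈ S 𝒦₃ → □ R (□ T U) ≐ □ R′ (□ T′ U)) →
           comp 𝒦₃ T R ⇔ comp 𝒦₃ T′ R′
  comp-⇔ {T = T} {R} {T′} {R′} eq =
    comp-⇒ {T = T} {R} {T′} {R′} (proj₂ ∘ eq) ,
    comp-⇒ {T = T′} {R′} {T} {R} (proj₁ ∘ eq)

  comp-⇔⁻ : {X₂ X₂′ : Set ℓ} {T : Relation X₂ X₃} {R : Relation X₁ X₂}
            {T′ : Relation X₂′ X₃} {R′ : Relation X₁ X₂′} →
            comp 𝒦₃ T R ⇔ comp 𝒦₃ T′ R′ →
            ∀ {A : Pred X₃ a} → A ∈ S 𝒦₃ → □ R (□ T A) ≐ □ R′ (□ T′ A)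
  comp-⇔⁻ {T = T} {R} {T′} {R′} (to , from) A∈S =
    let U , U∈S , A≐U = S-small 𝒦₃ A∈S
    in (λ sub R′xy T′yz → proj₂ A≐U (from (λ V _ RT⊆V → RT⊆V (_ , R′xy , T′yz)) U U∈S
          (λ (y , Rxy , Tyz) → proj₁ A≐U (sub Rxy Tyz)))) ,
       (λ sub Rxy Tyz → proj₂ A≐U (to (λ V _ RT⊆V → RT⊆V (_ , Rxy , Tyz)) U U∈S
          (λ (y , R′xy , T′yz) → proj₁ A≐U (sub R′xy T′yz))))

module _ {X : Set ℓ} (𝒦 : Family X) where

  cl-isMeetRelation : IsMeetRelation 𝒦 𝒦 (cl 𝒦)
  cl-isMeetRelation = record
    { □-S    = λ U∈S → S-resp 𝒦 (≐-sym (□-cl 𝒦 U∈S)) U∈S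
    ; closed = λ x →
        (λ y∈cl U (_ , cl⊆U) → cl⊆U y∈cl) ,
        (λ y∈ U (U∈S , x∈U) → y∈ U (U∈S , cl-⊆ 𝒦 U∈S x∈U))
    }

module _ {X₁ X₂ : Set ℓ} {𝒦₁ : Family X₁} {𝒦₂ : Family X₂}
         {T : Relation X₁ X₂} (isMeet : IsMeetRelation 𝒦₁ 𝒦₂ T) where
  open IsMeetRelation isMeet

  meet-∈𝒞 : ∀ x → T x ∈ 𝒞 𝒦₂
  meet-∈𝒞 x = ⋂-∈𝒞 𝒦₂ proj₁ (closed x)

  comp-identityˡ : comp 𝒦₂ (cl 𝒦₂) T ⇔ T
  comp-identityˡ =
    (λ z∈ → proj₂ (closed _) (λ U (U∈S , Tx⊆U) →
      z∈ U U∈S (λ (_ , Txy , y≥z) → cl-⊆ 𝒦₂ U∈S (Tx⊆U Txy) y≥z))) ,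
    (λ Txz U U∈S sub → sub (_ , Txz , cl-refl 𝒦₂))

  comp-identityʳ : comp 𝒦₂ T (cl 𝒦₁) ⇔ T
  comp-identityʳ =
    (λ z∈ → proj₂ (closed _) (λ U (U∈S , Tx⊆U) →
      z∈ U U∈S (λ (_ , x≥y , Tyz) → cl-⊆ 𝒦₁ (□-S U∈S) Tx⊆U x≥y Tyz))) ,
    (λ Txz U U∈S sub → sub (_ , cl-refl 𝒦₁ , Txz))

module _ {X₁ X₂ X₃ : Set ℓ}
         {𝒦₁ : Family X₁} {𝒦₂ : Family X₂} {𝒦₃ : Family X₃}
         {T : Relation X₂ X₃} {R : Relation X₁ X₂} where

  comp-isMeetRelation : IsMeetRelation 𝒦₂ 𝒦₃ T → IsMeetRelation 𝒦₁ 𝒦₂ R →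
                        IsMeetRelation 𝒦₁ 𝒦₃ (comp 𝒦₃ T R)
  comp-isMeetRelation T-meet R-meet = record
    { □-S    = λ U∈S → S-resp 𝒦₁ (≐-sym (□-comp 𝒦₃ T R U∈S))
                 (□-S′ (IsMeetRelation.□-S R-meet) (IsMeetRelation.□-S T-meet U∈S))
    ; closed = λ x →
        (λ z∈ U (_ , TR⊆U) → TR⊆U z∈) ,
        (λ z∈ U U∈S sub → z∈ U (U∈S , λ w∈ → w∈ U U∈S sub))
    }

comp-assoc : {X₁ X₂ X₃ X₄ : Set ℓ} (𝒦₃ : Family X₃) (𝒦₄ : Family X₄)
             {Q : Relation X₃ X₄} (T : Relation X₂ X₃) (R : Relation X₁ X₂) →
             (∀ {U : 𝒫 X₄} → U ∈ S 𝒦₄ → □ Q U ∈ S 𝒦₃) →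
             comp 𝒦₄ (comp 𝒦₄ Q T) R ⇔ comp 𝒦₄ Q (comp 𝒦₃ T R)
comp-assoc 𝒦₃ 𝒦₄ {Q} T R □-S =
  comp-⇔ 𝒦₄ {T = comp 𝒦₄ Q T} {R} {Q} {comp 𝒦₃ T R} λ U∈S →
    ≐-trans (□-cong R (□-comp 𝒦₄ Q T U∈S)) (≐-sym (□-comp 𝒦₃ T R (□-S U∈S)))


------------------------------------------------------------------------
-- Data from which StructureCategory below makes a category: composition is
-- *, identities are cl, and arrows are compared as relations.

record Structures (ℓ : Level) : Set (suc (suc (suc ℓ))) where
  infix 4 _≋_
  field
    Obj     : Set (suc (suc ℓ))
    Carrier : Obj → Set ℓ
    𝒦       : ∀ A → Family (Carrier A)

    _≋_     : Rel Obj (suc ℓ)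
    ≋-refl  : Reflexive _≋_
    ≋-sym   : Symmetric _≋_
    ≋-trans : Transitive _≋_
    carrier : ∀ {A B} → A ≋ B → Carrier A ≡ Carrier B
    𝒦-≐     : ∀ {A B} (p : A ≋ B) → subst Family (carrier p) (𝒦 A) ≐ 𝒦 B

    IsMorphism : ∀ A B → Relation (Carrier A) (Carrier B) → Set (suc (suc ℓ))
    isMeet : ∀ {A B M} → IsMorphism A B M → IsMeetRelation (𝒦 A) (𝒦 B) M
    cl-isMorphism : ∀ A → IsMorphism A A (cl (𝒦 A))
    comp-isMorphism : ∀ {A B C N M} → IsMorphism B C N → IsMorphism A B M →
                      IsMorphism A C (comp (𝒦 C) N M)

⇔-refl : {X Y : Set ℓ} {R : Relation X Y} → R ⇔ R
⇔-refl = id , id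

⇔-sym : {X Y : Set ℓ} {R T : Relation X Y} → R ⇔ T → T ⇔ R
⇔-sym (f , g) = g , f

⇔-trans : {X Y : Set ℓ} {Q R T : Relation X Y} → Q ⇔ R → R ⇔ T → Q ⇔ T
⇔-trans (f , g) (f′ , g′) = f′ ∘ f , g ∘ g′

private
  module Transport {ℓ : Level} where

    ≡-⇔ : {X Y : Set ℓ} (p : X ≡ X) (q : Y ≡ Y) {R T : Relation X Y} →
          R ⇔ T → subst₂ Relation p q R ⇔ T
    ≡-⇔ refl refl eq = eq

    sym-⇔ : {X X′ Y Y′ : Set ℓ} (p : X ≡ X′) (q : Y ≡ Y′)
            (p′ : X′ ≡ X) (q′ : Y′ ≡ Y)
            {R : Relation X Y} {T : Relation X′ Y′} →
            subst₂ Relation p q R ⇔ T → subst₂ Relation p′ q′ T ⇔ R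
    sym-⇔ refl refl refl refl = ⇔-sym

    trans-⇔ : {X X′ X″ Y Y′ Y″ : Set ℓ} (p : X ≡ X′) (q : Y ≡ Y′)
              (p′ : X′ ≡ X″) (q′ : Y′ ≡ Y″) (p″ : X ≡ X″) (q″ : Y ≡ Y″)
              {Q : Relation X Y} {R : Relation X′ Y′} {T : Relation X″ Y″} →
              subst₂ Relation p q Q ⇔ R → subst₂ Relation p′ q′ R ⇔ T →
              subst₂ Relation p″ q″ Q ⇔ T
    trans-⇔ refl refl refl refl refl refl {T = T} Q⇔R R⇔T = ⇔-trans {T = T} Q⇔R R⇔T

    S-cong : {X : Set ℓ} {𝒦 𝒦′ : Family X} → 𝒦 ≐ 𝒦′ →
             {A : Pred X a} → A ∈ S 𝒦 → A ∈ S 𝒦′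
    S-cong 𝒦≐ (U , U∈𝒦 , A≐) = U , proj₁ 𝒦≐ U∈𝒦 , A≐

    cl-cong : {X X′ : Set ℓ} (p : X ≡ X′) (q : X ≡ X′)
              {𝒦 : Family X} {𝒦′ : Family X′} (r : X ≡ X′) →
              subst Family r 𝒦 ≐ 𝒦′ → subst₂ Relation p q (cl 𝒦) ⇔ cl 𝒦′
    cl-cong refl refl refl 𝒦≐ =
      (λ y∈ U (U∈S , x∈U) → y∈ U (S-cong (≐-sym 𝒦≐) U∈S , x∈U)) ,
      (λ y∈ U (U∈S , x∈U) → y∈ U (S-cong 𝒦≐ U∈S , x∈U))

    comp-cong : {X X′ Y Y′ Z Z′ : Set ℓ} (p : X ≡ X′) (q q′ : Y ≡ Y′)
                (r s : Z ≡ Z′) (p′ : X ≡ X′) (r′ : Z ≡ Z′)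
                {𝒦 : Family Z} {𝒦′ : Family Z′}
                {R : Relation X Y} {R′ : Relation X′ Y′}
                {T : Relation Y Z} {T′ : Relation Y′ Z′} →
                subst Family s 𝒦 ≐ 𝒦′ →
                subst₂ Relation q′ r T ⇔ T′ → subst₂ Relation p q R ⇔ R′ →
                subst₂ Relation p′ r′ (comp 𝒦 T R) ⇔ comp 𝒦′ T′ R′
    comp-cong refl refl refl refl refl refl refl 𝒦≐ (T⇒ , T⇐) (R⇒ , R⇐) =
      (λ z∈ U U∈S sub → z∈ U (S-cong (≐-sym 𝒦≐) U∈S)
        (λ (y , Rxy , Tyz) → sub (y , R⇒ Rxy , T⇒ Tyz))) ,
      (λ z∈ U U∈S sub → z∈ U (S-cong 𝒦≐ U∈S)
        (λ (y , Rxy , Tyz) → sub (y , R⇐ Rxy , T⇐ Tyz)))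

module StructureCategory {ℓ : Level} (𝕊 : Structures ℓ) where
  open Structures 𝕊
  open Transport

  record Arrow (A B : Obj) : Set (suc (suc ℓ)) where
    field
      graph      : Relation (Carrier A) (Carrier B)
      isMorphism : IsMorphism A B graph
  open Arrow public

  record EqualArrows {A B A′ B′} (f : Arrow A B) (g : Arrow A′ B′) :
      Set (suc ℓ) where
    field
      dom      : A ≋ A′
      cod      : B ≋ B′
      graph-⇔  : subst₂ Relation (carrier dom) (carrier cod) (graph f) ⇔ graph g
  open EqualArrows public

  private
    parallel : ∀ {A B} {f g : Arrow A B} → graph f ⇔ graph g → EqualArrows f g
    parallel eq = record
      { dom = ≋-refl ; cod = ≋-refl
      ; graph-⇔ = ≡-⇔ (carrier ≋-refl) (carrier ≋-refl) eq }

  category : Category (suc (suc ℓ)) (suc (suc ℓ)) (suc ℓ)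
  category = record
    { Obj = Obj
    ; Hom = Arrow
    ; _≋_ = _≋_
    ; _≈_ = EqualArrows
    ; Id  = λ A → record { graph = cl (𝒦 A) ; isMorphism = cl-isMorphism A }
    ; _⊚_ = λ {A} {B} {C} g f → record
        { graph = comp (𝒦 C) (graph g) (graph f)
        ; isMorphism = comp-isMorphism (isMorphism g) (isMorphism f) }
    ; ≋-refl  = ≋-refl
    ; ≋-sym   = ≋-sym
    ; ≋-trans = ≋-trans
    ; ≈-refl  = λ {_} {_} {f} → parallel (⇔-refl {R = graph f})
    ; ≈-sym   = λ e → record
        { dom = ≋-sym (dom e) ; cod = ≋-sym (cod e)
        ; graph-⇔ = sym-⇔ (carrier (dom e)) (carrier (cod e)) _ _ (graph-⇔ e) }
    ; ≈-trans = λ {f = f} {g} {h} d e → record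
        { dom = ≋-trans (dom d) (dom e) ; cod = ≋-trans (cod d) (cod e)
        ; graph-⇔ = trans-⇔ (carrier (dom d)) (carrier (cod d))
                            (carrier (dom e)) (carrier (cod e)) _ _
                            {graph f} {graph g} {graph h} (graph-⇔ d) (graph-⇔ e) }
    ; ≈-dom   = dom
    ; ≈-cod   = cod
    ; Id-cong = λ p → record
        { dom = p ; cod = p ; graph-⇔ = cl-cong (carrier p) (carrier p) (carrier p) (𝒦-≐ p) }
    ; ⊚-cong  = λ {f = f} {f′} {g} {g′} d e → record
        { dom = dom e ; cod = cod d
        ; graph-⇔ = comp-cong (carrier (dom e)) (carrier (cod e)) (carrier (dom d))
                      (carrier (cod d)) (carrier (cod d))
                      (carrier (dom e)) (carrier (cod d))
                      {R = graph f} {graph f′} {graph g} {graph g′}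
                      (𝒦-≐ (cod d)) (graph-⇔ d) (graph-⇔ e) }
    ; identityˡ = λ {_} {_} {f} → parallel (comp-identityˡ (isMeet (isMorphism f)))
    ; identityʳ = λ {_} {_} {f} → parallel (comp-identityʳ (isMeet (isMorphism f)))
    ; assoc     = λ {_} {_} {C} {D} {f} {g} {h} → parallel
        (comp-assoc (𝒦 C) (𝒦 D) (graph g) (graph f)
          (IsMeetRelation.□-S (isMeet (isMorphism h))))
    }

------------------------------------------------------------------------

record _≋ᴸ_ (A B : SLataSpace ℓ) : Set (suc ℓ) where
  private
    module A = SLataSpace A
    module B = SLataSpace B
  field
    carrier : A.Carrier ≡ B.Carrier
    𝒦-≐     : subst Family carrier A.𝒦 ≐ B.𝒦
    I-⇔     : subst MultiRelation carrier A.I ⇔ B.I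
    E-⇔     : subst MultiRelation carrier A.E ⇔ B.E

module _ {X : Set ℓ} (𝒦 : Family X) (R : MultiRelation X) where

  m-cong : {A : Pred X a} {B : Pred X b} → A ≐ B → m 𝒦 R A ≐ m 𝒦 R B
  m-cong (A⊆B , B⊆A) =
    (λ sub RxZ → let Z∈𝒵 , z , z∈Z , z∈A = sub RxZ in Z∈𝒵 , z , z∈Z , A⊆B z∈A) ,
    (λ sub RxZ → let Z∈𝒵 , z , z∈Z , z∈B = sub RxZ in Z∈𝒵 , z , z∈Z , B⊆A z∈B)

monotone′ : {X₁ X₂ : Set ℓ} {𝒦₁ : Family X₁} {R₁ : MultiRelation X₁}
            {𝒦₂ : Family X₂} {R₂ : MultiRelation X₂} {T : Relation X₁ X₂} →
            IsMonotone 𝒦₁ R₁ 𝒦₂ R₂ T → {A : Pred X₂ a} → A ∈ S 𝒦₂ →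
            □ T (m 𝒦₂ R₂ A) ≐ m 𝒦₁ R₁ (□ T A)
monotone′ {𝒦₁ = 𝒦₁} {R₁} {𝒦₂} {R₂} {T} mono A∈S =
  let U , U∈S , A≐U = S-small 𝒦₂ A∈S
  in ≐-trans (□-cong T (m-cong 𝒦₂ R₂ A≐U))
     (≐-trans (mono U∈S) (m-cong 𝒦₁ R₁ (□-cong T (≐-sym A≐U))))

cl-monotone : {X : Set ℓ} {𝒦 : Family X} {R : MultiRelation X} →
              IsMSSpace 𝒦 R → IsMonotone 𝒦 R 𝒦 R (cl 𝒦)
cl-monotone {𝒦 = 𝒦} {R} isMS U∈S =
  ≐-trans (□-cl 𝒦 (IsMSSpace.m1 isMS U∈S)) (m-cong 𝒦 R (≐-sym (□-cl 𝒦 U∈S)))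

comp-monotone :
  {X₁ X₂ X₃ : Set ℓ} {𝒦₁ : Family X₁} {R₁ : MultiRelation X₁}
  {𝒦₂ : Family X₂} {R₂ : MultiRelation X₂} {𝒦₃ : Family X₃} {R₃ : MultiRelation X₃}
  {N : Relation X₂ X₃} {M : Relation X₁ X₂} →
  IsMSSpace 𝒦₃ R₃ → IsMeetRelation 𝒦₂ 𝒦₃ N →
  IsMonotone 𝒦₂ R₂ 𝒦₃ R₃ N → IsMonotone 𝒦₁ R₁ 𝒦₂ R₂ M →
  IsMonotone 𝒦₁ R₁ 𝒦₃ R₃ (comp 𝒦₃ N M)
comp-monotone {𝒦₁ = 𝒦₁} {R₁} {𝒦₂} {R₂} {𝒦₃} {R₃} {N} {M} isMS N-meet N-mono M-mono U∈S =
  ≐-trans (□-comp 𝒦₃ N M (IsMSSpace.m1 isMS U∈S))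
  (≐-trans (□-cong M (N-mono U∈S))
  (≐-trans (monotone′ {R₁ = R₁} {R₂ = R₂} M-mono (IsMeetRelation.□-S N-meet U∈S))
           (m-cong 𝒦₁ R₁ (≐-sym (□-comp 𝒦₃ N M U∈S)))))

private
  module FieldTransport {ℓ : Level} where

    sym-𝒦 : {X Y : Set ℓ} (p : X ≡ Y) {𝒦 : Family X} {𝒦′ : Family Y} →
            subst Family p 𝒦 ≐ 𝒦′ → subst Family (sym p) 𝒦′ ≐ 𝒦
    sym-𝒦 refl = ≐-sym

    trans-𝒦 : {X Y Z : Set ℓ} (p : X ≡ Y) (q : Y ≡ Z)
              {𝒦 : Family X} {𝒦′ : Family Y} {𝒦″ : Family Z} →
              subst Family p 𝒦 ≐ 𝒦′ → subst Family q 𝒦′ ≐ 𝒦″ →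
              subst Family (trans p q) 𝒦 ≐ 𝒦″
    trans-𝒦 refl refl = ≐-trans

    sym-R : {X Y : Set ℓ} (p : X ≡ Y) {R : MultiRelation X} {R′ : MultiRelation Y} →
            subst MultiRelation p R ⇔ R′ → subst MultiRelation (sym p) R′ ⇔ R
    sym-R refl (f , g) = g , f

    trans-R : {X Y Z : Set ℓ} (p : X ≡ Y) (q : Y ≡ Z)
              {R : MultiRelation X} {R′ : MultiRelation Y} {R″ : MultiRelation Z} →
              subst MultiRelation p R ⇔ R′ → subst MultiRelation q R′ ⇔ R″ →
              subst MultiRelation (trans p q) R ⇔ R″
    trans-R refl refl (f , g) (f′ , g′) = f′ ∘ f , g ∘ g′

    sym-T : {X Y : Set ℓ} (p : X ≡ Y) {T : Relation X X} {T′ : Relation Y Y} →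
            subst (λ X → Relation X X) p T ⇔ T′ →
            subst (λ X → Relation X X) (sym p) T′ ⇔ T
    sym-T refl (f , g) = g , f

    trans-T : {X Y Z : Set ℓ} (p : X ≡ Y) (q : Y ≡ Z)
              {T : Relation X X} {T′ : Relation Y Y} {T″ : Relation Z Z} →
              subst (λ X → Relation X X) p T ⇔ T′ →
              subst (λ X → Relation X X) q T′ ⇔ T″ →
              subst (λ X → Relation X X) (trans p q) T ⇔ T″
    trans-T refl refl (f , g) (f′ , g′) = f′ ∘ f , g ∘ g′

open FieldTransport

≋ᴸ-sym : {A B : SLataSpace ℓ} → A ≋ᴸ B → B ≋ᴸ A
≋ᴸ-sym {A = A} {B} e = record
  { carrier = sym carrier
  ; 𝒦-≐     = sym-𝒦 carrier 𝒦-≐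
  ; I-⇔     = sym-R carrier {I A} {I B} I-⇔
  ; E-⇔     = sym-R carrier {E A} {E B} E-⇔
  }
  where
  open _≋ᴸ_ e
  open SLataSpace using (I; E)

≋ᴸ-trans : {A B C : SLataSpace ℓ} → A ≋ᴸ B → B ≋ᴸ C → A ≋ᴸ C
≋ᴸ-trans {A = A} {B} {C} d e = record
  { carrier = trans d.carrier e.carrier
  ; 𝒦-≐     = trans-𝒦 d.carrier e.carrier d.𝒦-≐ e.𝒦-≐
  ; I-⇔     = trans-R d.carrier e.carrier {I A} {I B} {I C} d.I-⇔ e.I-⇔
  ; E-⇔     = trans-R d.carrier e.carrier {E A} {E B} {E C} d.E-⇔ e.E-⇔
  }
  where
  module d = _≋ᴸ_ d
  module e = _≋ᴸ_ e
  open SLataSpace using (I; E)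

cl-isSLataRelation : (A : SLataSpace ℓ) → IsSLataRelation A A (cl (SLataSpace.𝒦 A))
cl-isSLataRelation A = record
  { isMeetRelation = cl-isMeetRelation 𝒦
  ; monotone-I     = cl-monotone A1-I
  ; monotone-E     = cl-monotone A1-E
  }
  where
  open SLataSpace A

comp-isSLataRelation : {A B C : SLataSpace ℓ} →
  ∀ {N M} → IsSLataRelation B C N → IsSLataRelation A B M →
  IsSLataRelation A C (comp (SLataSpace.𝒦 C) N M)
comp-isSLataRelation {A = A} {B} {C} N-mor M-mor = record
  { isMeetRelation = comp-isMeetRelation N.isMeetRelation M.isMeetRelation
  ; monotone-I = comp-monotone {R₁ = I A} {R₂ = I B} (A1-I C)
                   N.isMeetRelation N.monotone-I M.monotone-I
  ; monotone-E = comp-monotone {R₁ = E A} {R₂ = E B} (A1-E C)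
                   N.isMeetRelation N.monotone-E M.monotone-E
  }
  where
  module N = IsSLataRelation N-mor
  module M = IsSLataRelation M-mor
  open SLataSpace using (I; E; A1-I; A1-E)

SLata-structures : (ℓ : Level) → Structures ℓ
SLata-structures ℓ = record
  { Obj     = SLataSpace ℓ
  ; Carrier = λ A → SLataSpace.Carrier A
  ; 𝒦       = SLataSpace.𝒦
  ; _≋_     = _≋ᴸ_
  ; ≋-refl  = record
      { carrier = refl ; 𝒦-≐ = ≐-refl ; I-⇔ = id , id ; E-⇔ = id , id }
  ; ≋-sym   = ≋ᴸ-sym
  ; ≋-trans = ≋ᴸ-trans
  ; carrier = _≋ᴸ_.carrier
  ; 𝒦-≐     = _≋ᴸ_.𝒦-≐
  ; IsMorphism = IsSLataRelation
  ; isMeet  = IsSLataRelation.isMeetRelation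
  ; cl-isMorphism   = cl-isSLataRelation
  ; comp-isMorphism = λ {A} {B} {C} → comp-isSLataRelation {A = A} {B} {C}
  }

SLataSp : (ℓ : Level) → Category (suc (suc ℓ)) (suc (suc ℓ)) (suc ℓ)
SLataSp ℓ = StructureCategory.category (SLata-structures ℓ)

------------------------------------------------------------------------

record _≋ᴿ_ (A B : RelSSpace ℓ) : Set (suc ℓ) where
  private
    module A = RelSSpace A
    module B = RelSSpace B
  field
    carrier : A.Carrier ≡ B.Carrier
    𝒦-≐     : subst Family carrier A.𝒦 ≐ B.𝒦
    T-⇔     : subst (λ X → Relation X X) carrier A.T ⇔ B.T

module _ {X : Set ℓ} {𝒦 : Family X} {T : Relation X X} where

  ⋂F-unit : (A : Pred X a) → A ⊆ □ T (⋂ (F 𝒦 T A))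
  ⋂F-unit A x∈A Txy U (_ , A⊆□U) = A⊆□U x∈A Txy

  ⋂F-least : {A : Pred X a} {B : Pred X b} → B ∈ S 𝒦 →
             A ⊆ □ T B → ⋂ (F 𝒦 T A) ⊆ B
  ⋂F-least B∈S A⊆□B x∈ =
    let U , U∈S , B≐U = S-small 𝒦 B∈S
    in proj₂ B≐U (x∈ U (U∈S , λ x∈A Txy → proj₁ B≐U (A⊆□B x∈A Txy)))

cl-isAdjointPreserving : (A : RelSSpace ℓ) →
  IsAdjointPreserving A A (cl (RelSSpace.𝒦 A))
cl-isAdjointPreserving A = record
  { isMeetRelation = cl-isMeetRelation 𝒦
  ; commutes = comp-⇔ 𝒦 {T = cl 𝒦} {T} {T} {cl 𝒦} λ U∈S →
      ≐-trans (□-cong T (□-cl 𝒦 U∈S)) (≐-sym (□-cl 𝒦 (□-S U∈S)))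
  ; adjoint = λ {U} {V} U∈S V∈S sub x x∈ →
      cl-∈𝒞 𝒦 x ,
      cl-⊆ 𝒦 U∈S (⋂F-least {𝒦 = 𝒦} {T} U∈S
        (λ {y} y∈V → proj₂ (sub y (cl-∈𝒞 𝒦 y , cl-⊆ 𝒦 V∈S y∈V)))
        (λ W W∈F → proj₂ (x∈ W∈F) (cl-refl 𝒦)))
  }
  where
  open RelSSpace A
  open IsARelation isARelation

comp-isAdjointPreserving : {A B C : RelSSpace ℓ} →
  ∀ {N M} → IsAdjointPreserving B C N → IsAdjointPreserving A B M →
  IsAdjointPreserving A C (comp (RelSSpace.𝒦 C) N M)
comp-isAdjointPreserving {A = A} {B} {C} {N} {M} N-adj M-adj = record
  { isMeetRelation = NM-meet
  ; commutes = comp-⇔ C.𝒦 {T = NM} {A.T} {C.T} {NM} λ {U} U∈S →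
      ≐-trans (□-cong A.T (□-comp C.𝒦 N M U∈S))
      (≐-trans (comp-⇔⁻ B.𝒦 {T = M} {A.T} {B.T} {M} M.commutes (N-□ U∈S))
      (≐-trans (□-cong M (comp-⇔⁻ C.𝒦 {T = N} {B.T} {C.T} {N} N.commutes U∈S))
               (≐-sym (□-comp C.𝒦 N M (C.□-S U∈S)))))
  ; adjoint = λ {U} {W} U∈S W∈S sub x x∈ → let
        V , V∈S , □N≐V = S-small B.𝒦 (N-□ W∈S)
        P , P∈S , ⋂F≐P = S-small B.𝒦 (B.⋂F-S V∈S)
        N⋂F⊆P = λ y (Ny⊆⋂F : N y ⊆ ⋂ (F C.𝒦 C.T W)) →
          proj₂ (N.adjoint P∈S W∈S
            (λ z Nz∈D → B.T∈𝒞 z , λ Tzw → proj₁ ⋂F≐P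
              (⋂F-unit {𝒦 = B.𝒦} {B.T} V (proj₁ □N≐V (proj₂ Nz∈D)) Tzw))
            y
            (λ {W′} W′∈F → meet-∈𝒞 N.isMeetRelation y , λ Nyz → Ny⊆⋂F Nyz W′ W′∈F))
            (cl-refl B.𝒦)
      in M.adjoint U∈S V∈S
           (λ y My∈D → sub y (meet-∈𝒞 NM-meet y ,
              proj₂ (□-comp C.𝒦 N M W∈S) (□-mono M (proj₂ □N≐V) (proj₂ My∈D))))
           x
           (λ {V′} V′∈F → meet-∈𝒞 M.isMeetRelation x , λ {y} Mxy →
              proj₂ ⋂F≐P
                (N⋂F⊆P y λ Nyz W′ W′∈F → proj₂ (x∈ W′∈F)
                  (λ Q Q∈S NM⊆Q → NM⊆Q (y , Mxy , Nyz)))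
                V′ V′∈F)
  }
  where
  module A = RelSSpace A
  module B where
    open RelSSpace B public
    open IsARelation isARelation public
  module C where
    open RelSSpace C public
    open IsARelation isARelation public
  module N = IsAdjointPreserving N-adj
  module M = IsAdjointPreserving M-adj
  NM = comp C.𝒦 N M
  NM-meet = comp-isMeetRelation N.isMeetRelation M.isMeetRelation
  N-□ = IsMeetRelation.□-S N.isMeetRelation

≋ᴿ-sym : {A B : RelSSpace ℓ} → A ≋ᴿ B → B ≋ᴿ A
≋ᴿ-sym {A = A} {B} e = record
  { carrier = sym carrier
  ; 𝒦-≐     = sym-𝒦 carrier 𝒦-≐
  ; T-⇔     = sym-T carrier {T A} {T B} T-⇔
  }
  where
  open _≋ᴿ_ e
  open RelSSpace using (T)

≋ᴿ-trans : {A B C : RelSSpace ℓ} → A ≋ᴿ B → B ≋ᴿ C → A ≋ᴿ C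
≋ᴿ-trans {A = A} {B} {C} d e = record
  { carrier = trans d.carrier e.carrier
  ; 𝒦-≐     = trans-𝒦 d.carrier e.carrier d.𝒦-≐ e.𝒦-≐
  ; T-⇔     = trans-T d.carrier e.carrier {T A} {T B} {T C} d.T-⇔ e.T-⇔
  }
  where
  module d = _≋ᴿ_ d
  module e = _≋ᴿ_ e
  open RelSSpace using (T)

RelS-structures : (ℓ : Level) → Structures ℓ
RelS-structures ℓ = record
  { Obj     = RelSSpace ℓ
  ; Carrier = λ A → RelSSpace.Carrier A
  ; 𝒦       = RelSSpace.𝒦
  ; _≋_     = _≋ᴿ_
  ; ≋-refl  = record { carrier = refl ; 𝒦-≐ = ≐-refl ; T-⇔ = id , id }
  ; ≋-sym   = ≋ᴿ-sym
  ; ≋-trans = ≋ᴿ-trans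
  ; carrier = _≋ᴿ_.carrier
  ; 𝒦-≐     = _≋ᴿ_.𝒦-≐
  ; IsMorphism = IsAdjointPreserving
  ; isMeet  = IsAdjointPreserving.isMeetRelation
  ; cl-isMorphism   = cl-isAdjointPreserving
  ; comp-isMorphism = λ {A} {B} {C} → comp-isAdjointPreserving {A = A} {B} {C}
  }

RelSP : (ℓ : Level) → Category (suc (suc ℓ)) (suc (suc ℓ)) (suc ℓ)
RelSP ℓ = StructureCategory.category (RelS-structures ℓ)

{-# OPTIONS --safe #-}

-- On the lattice side, axioms A2 and A3 say that m I is left adjoint to m E on
-- S 𝒦, so m E preserves finite meets.  For fixed x the family of all U ∈ S 𝒦
-- with x ∈ m E U is therefore a filter, and compactness of the members of 𝒦
-- shows that a filter contains every member of S 𝒦 above its intersection.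
-- Hence T x = ⋂ {U ∈ S 𝒦 : x ∈ m E U} satisfies □ T = m E, and V ↦ ⋂ (F T V) is
-- its left adjoint m I.  Conversely, every monotone h : S 𝒦 → S 𝒦 is m R for a
-- unique R, which turns □ T and its left adjoint into E and I.  A meet-relation
-- commutes with m E iff it commutes with T, and it then commutes with m I iff it
-- satisfies the adjoint condition, so both categories have the same arrows.

module Submission where

open import Defs
open import Level using (Level; suc; Lift; lift; lower)
open import Axiom.ExcludedMiddle using (ExcludedMiddle)
open import Data.Empty using (⊥; ⊥-elim)
open import Data.List.Base using ([]; _∷_)
open import Data.List.Relation.Unary.All using (All; []; _∷_; head)
open import Data.List.Relation.Unary.Any using (Any; here; there)
open import Data.Product.Base using (∃-syntax; _×_; _,_; proj₁; proj₂)
open import Data.Sum.Base using (inj₁; inj₂)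
open import Function.Base using (id; _∘_)
open import Relation.Binary.Core using (_⇔_)
open import Relation.Binary.PropositionalEquality.Core using (_≡_; refl; subst)
open import Relation.Nullary.Decidable
  using (True; toWitness; fromWitness; decidable-stable)
open import Relation.Unary
  using (Pred; _∈_; _⊆_; _≐_; _∩_; ∁; _≬_; Satisfiable)
open import Relation.Unary.Polymorphic using (∅)
open import Relation.Unary.Properties using (≐-refl; ≐-sym; ≐-trans)

private
  variable
    a b ℓ : Level

-- Closure properties of `S 𝒦` and of the operator `⋂ (F 𝒦 T -)`.

S-cong : {X : Set ℓ} {𝒦 𝒦′ : Family X} → 𝒦 ≐ 𝒦′ →
         {A : Pred X a} → A ∈ S 𝒦 → A ∈ S 𝒦′
S-cong (𝒦⊆ , _) (U , U∈𝒦 , A≐) = U , 𝒦⊆ U∈𝒦 , A≐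

𝒵-cong : {X : Set ℓ} {𝒦 𝒦′ : Family X} → 𝒦 ≐ 𝒦′ → 𝒵 𝒦 ⊆ 𝒵 𝒦′
𝒵-cong (𝒦⊆ , _) (ℒ , ℒ⊆𝒦 , rest) = ℒ , 𝒦⊆ ∘ ℒ⊆𝒦 , rest

module _ {X : Set ℓ} {𝒦 : Family X} where

  S-∩ : IsSSpace 𝒦 → {A B : 𝒫 X} → A ∈ S 𝒦 → B ∈ S 𝒦 → A ∩ B ∈ S 𝒦
  S-∩ isSSpace (U , U∈𝒦 , A≐) (V , V∈𝒦 , B≐) =
    _ , IsSSpace.S2-∪ isSSpace U∈𝒦 V∈𝒦 ,
    (λ { (x∈A , _) (inj₁ x∈U) → proj₁ A≐ x∈A x∈U
       ; (_ , x∈B) (inj₂ x∈V) → proj₁ B≐ x∈B x∈V }) ,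
    (λ x∉ → proj₂ A≐ (x∉ ∘ inj₁) , proj₂ B≐ (x∉ ∘ inj₂))

  S-full : IsSSpace 𝒦 → ∁ {ℓ = ℓ} ∅ ∈ S 𝒦
  S-full isSSpace = ∅ , IsSSpace.S2-∅ isSSpace , ≐-refl

  ⋂F-mono : {T : Relation X X} {A : Pred X a} {B : Pred X b} →
            A ⊆ B → ⋂ (F 𝒦 T A) ⊆ ⋂ (F 𝒦 T B)
  ⋂F-mono A⊆B x∈ U (U∈S , B⊆□U) = x∈ U (U∈S , λ x∈A → B⊆□U (A⊆B x∈A))

  ⋂F-cong : {T : Relation X X} {A : Pred X a} {B : Pred X b} →
            A ≐ B → ⋂ (F 𝒦 T A) ≐ ⋂ (F 𝒦 T B)
  ⋂F-cong {T = T} (A⊆B , B⊆A) = ⋂F-mono {T = T} A⊆B , ⋂F-mono {T = T} B⊆A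

-- Relations induced by multirelations.

module _ {X : Set ℓ} (𝒦 : Family X) where

  -- The second component is x ∈ m 𝒦 R U without the membership of Z in 𝒵, which
  -- would raise the universe level.
  meetsOf : MultiRelation X → X → Family X
  meetsOf R x U = U ∈ S 𝒦 × (∀ {Z} → Z ∈ R x → Z ≬ U)

  relationOf : MultiRelation X → Relation X X
  relationOf R x = ⋂ (meetsOf R x)

  □≐m-S : {T : Relation X X} {R : MultiRelation X} →
          (∀ {U : 𝒫 X} → U ∈ S 𝒦 → □ T U ≐ m 𝒦 R U) →
          {A : Pred X a} → A ∈ S 𝒦 → □ T A ≐ m 𝒦 R A
  □≐m-S {T = T} {R} □≐m A∈S =
    let U , U∈S , A≐U = S-small 𝒦 A∈S
    in ≐-trans (□-cong T A≐U) (≐-trans (□≐m U∈S) (m-cong 𝒦 R (≐-sym A≐U)))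

-- The interface between the two kinds of structure. It holds for both translations of objects, so
-- the comparison of arrows is carried out once, from these two equations.
record Corresponds {X : Set ℓ} (𝒦 : Family X) (I E : MultiRelation X)
                   (T : Relation X X) : Set (suc (suc ℓ)) where
  field
    □≐m  : {U : 𝒫 X} → U ∈ S 𝒦 → □ T U ≐ m 𝒦 E U
    ⋂F≐m : {U : 𝒫 X} → U ∈ S 𝒦 → ⋂ (F 𝒦 T U) ≐ m 𝒦 I U

  □≐m′ : {A : Pred X a} → A ∈ S 𝒦 → □ T A ≐ m 𝒦 E A
  □≐m′ = □≐m-S 𝒦 □≐m

  ⋂F≐m′ : {A : Pred X a} → A ∈ S 𝒦 → ⋂ (F 𝒦 T A) ≐ m 𝒦 I A
  ⋂F≐m′ A∈S =
    let U , U∈S , A≐U = S-small 𝒦 A∈S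
    in ≐-trans (⋂F-cong {T = T} A≐U)
       (≐-trans (⋂F≐m U∈S) (m-cong 𝒦 I (≐-sym A≐U)))

-- The adjunction between `m 𝒦 I` and `m 𝒦 E`, and the filters it yields.

module SLata (A : SLataSpace ℓ) where
  open SLataSpace A public
  module I = IsMSSpace A1-I
  module E = IsMSSpace A1-E

  m-mono : (R : MultiRelation Carrier) {P : Pred Carrier a} {Q : Pred Carrier b} →
           P ⊆ Q → m 𝒦 R P ⊆ m 𝒦 R Q
  m-mono R P⊆Q sub Z∈R =
    let Z∈𝒵 , z , z∈Z , z∈P = sub Z∈R in Z∈𝒵 , z , z∈Z , P⊆Q z∈P

  unit : {P : Pred Carrier a} → P ∈ S 𝒦 → P ⊆ m 𝒦 E (m 𝒦 I P)
  unit P∈S x∈P Z∈E =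
    let U , U∈S , P≐U = S-small 𝒦 P∈S
        w , w∈Z , Iw⊆ = A2 U∈S (proj₁ P≐U x∈P) Z∈E
    in E.R⊆𝒵 _ Z∈E , w , w∈Z , m-mono I (proj₂ P≐U) Iw⊆

  counit : {P : Pred Carrier a} → P ∈ S 𝒦 → m 𝒦 I (m 𝒦 E P) ⊆ P
  counit P∈S x∈ =
    let U , U∈S , P≐U = S-small 𝒦 P∈S
    in proj₂ P≐U (A3 U∈S (λ Z∈I →
         let _ , y , y∈Z , Ey⊆ = x∈ Z∈I in y , y∈Z , m-mono E (proj₁ P≐U) Ey⊆))

  meetsOf-E⇒m : ∀ {x U} → U ∈ meetsOf 𝒦 E x → x ∈ m 𝒦 E U
  meetsOf-E⇒m (_ , meets) Z∈E = E.R⊆𝒵 _ Z∈E , meets Z∈E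

  m⇒meetsOf-E : ∀ {x} {P : Pred Carrier a} {U} →
                U ∈ S 𝒦 → P ⊆ U → x ∈ m 𝒦 E P → U ∈ meetsOf 𝒦 E x
  m⇒meetsOf-E U∈S P⊆U x∈ =
    U∈S , λ Z∈E → let _ , z , z∈Z , z∈P = x∈ Z∈E in z , z∈Z , P⊆U z∈P

  meetsOf-E-inhabited : ∀ x → Satisfiable (meetsOf 𝒦 E x)
  meetsOf-E-inhabited x =
    let top = S-full I.isSSpace
    -- The unit puts `x` in `m 𝒦 E (m 𝒦 I ⊤)` for the whole space `⊤`, and `m 𝒦 I ⊤ ⊆ ⊤`.
    in _ , m⇒meetsOf-E top (λ _ ()) (unit top {x} (λ ()))

  -- A right adjoint preserves meets: the lower bound is `m 𝒦 I (m 𝒦 E U ∩ m 𝒦 E V)`. The unit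
  -- places it in the filter, and the counit places it below `U` and `V`.
  meetsOf-E-directed : ∀ x {U V} → U ∈ meetsOf 𝒦 E x → V ∈ meetsOf 𝒦 E x →
                       ∃[ W ] W ∈ meetsOf 𝒦 E x × W ⊆ U × W ⊆ V
  meetsOf-E-directed x U∈ V∈ =
    let P , P∈S , m≐P = S-small 𝒦 (E.m1 (proj₁ U∈))
        Q , Q∈S , m≐Q = S-small 𝒦 (E.m1 (proj₁ V∈))
        P∩Q∈S = S-∩ I.isSSpace P∈S Q∈S
        W , W∈S , m≐W = S-small 𝒦 (I.m1 P∩Q∈S)
    in W ,
       m⇒meetsOf-E W∈S (proj₁ m≐W)
         (unit P∩Q∈S (proj₁ m≐P (meetsOf-E⇒m U∈) , proj₁ m≐Q (meetsOf-E⇒m V∈))) ,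
       (λ y∈W → counit (proj₁ U∈) (m-mono I (proj₂ m≐P ∘ proj₁) (proj₂ m≐W y∈W))) ,
       (λ y∈W → counit (proj₁ V∈) (m-mono I (proj₂ m≐Q ∘ proj₂) (proj₂ m≐W y∈W)))

  meetsOf-E-up : ∀ x {U V} → U ∈ meetsOf 𝒦 E x → V ∈ S 𝒦 → U ⊆ V → V ∈ meetsOf 𝒦 E x
  meetsOf-E-up x U∈ V∈S U⊆V = m⇒meetsOf-E V∈S U⊆V (meetsOf-E⇒m U∈)

-- Comparison of the two kinds of arrows.

module _ {A B : SLataSpace ℓ}
         {T₁ : Relation (SLataSpace.Carrier A) (SLataSpace.Carrier A)}
         {T₂ : Relation (SLataSpace.Carrier B) (SLataSpace.Carrier B)}
         (c₁ : Corresponds (SLataSpace.𝒦 A) (SLataSpace.I A) (SLataSpace.E A) T₁)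
         (c₂ : Corresponds (SLataSpace.𝒦 B) (SLataSpace.I B) (SLataSpace.E B) T₂)
         (r₁ : IsARelation (SLataSpace.𝒦 A) T₁)
         (r₂ : IsARelation (SLataSpace.𝒦 B) T₂)
  where
  private
    module A = SLataSpace A
    module B = SLataSpace B
    module r₁ = IsARelation r₁
    module r₂ = IsARelation r₂
    module c₁ = Corresponds c₁
    module c₂ = Corresponds c₂
    Rel₁ Rel₂ : RelSSpace ℓ
    Rel₁ = record { 𝒦 = A.𝒦 ; T = T₁ ; isSSpace = IsMSSpace.isSSpace A.A1-I
                  ; isARelation = r₁ }
    Rel₂ = record { 𝒦 = B.𝒦 ; T = T₂ ; isSSpace = IsMSSpace.isSSpace B.A1-I
                  ; isARelation = r₂ }

  SLata⇒adjointPreserving :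
    ∀ {M} → IsSLataRelation A B M → IsAdjointPreserving Rel₁ Rel₂ M
  SLata⇒adjointPreserving {M} isSLata = record
    { isMeetRelation = isMeetRelation
    ; commutes = comp-⇔ B.𝒦 {T = M} {T₁} {T₂} {M} λ U∈S →
        ≐-trans (c₁.□≐m′ (□-S U∈S))
        (≐-trans (≐-sym (monotone-E U∈S)) (□-cong M (≐-sym (c₂.□≐m U∈S))))
    -- By adjunction the hypothesis `sub` says that `⋂ (F A.𝒦 T₁ (□ M V)) ⊆ U`; `monotone-I`
    -- identifies this intersection with `□ M (⋂ (F B.𝒦 T₂ V))`, which contains `x`.
    ; adjoint = λ {U} {V} U∈S V∈S sub x x∈ →
        cl-∈𝒞 A.𝒦 x ,
        cl-⊆ A.𝒦 U∈S
          (⋂F-least {𝒦 = A.𝒦} {T₁} {A = □ M V} U∈S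
            (λ {y} My⊆V → proj₂ (sub y (meet-∈𝒞 isMeetRelation y , My⊆V)))
            (proj₂ (c₁.⋂F≐m′ (□-S V∈S))
              (proj₁ (monotone-I V∈S)
                (proj₁ (□-cong M (c₂.⋂F≐m V∈S))
                  (λ Mxy W W∈F → proj₂ (x∈ W∈F) Mxy)))))
    }
    where
    open IsSLataRelation isSLata
    open IsMeetRelation isMeetRelation

  adjointPreserving⇒SLata :
    ∀ {M} → IsAdjointPreserving Rel₁ Rel₂ M → IsSLataRelation A B M
  adjointPreserving⇒SLata {M} isAdjoint = record
    { isMeetRelation = isMeetRelation
    ; monotone-I = λ {V} V∈S →
        ≐-trans (□-cong M (≐-sym (c₂.⋂F≐m V∈S)))
        (≐-trans (□M⋂F⊆ V∈S , ⋂F□M⊆ V∈S) (c₁.⋂F≐m′ (□-S V∈S)))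
    ; monotone-E = λ U∈S →
        ≐-trans (□-cong M (≐-sym (c₂.□≐m U∈S)))
        (≐-trans (≐-sym (□-commutes U∈S)) (c₁.□≐m′ (□-S U∈S)))
    }
    where
    open IsAdjointPreserving isAdjoint
    open IsMeetRelation isMeetRelation

    □-commutes : {P : Pred B.Carrier a} → P ∈ S B.𝒦 → □ T₁ (□ M P) ≐ □ M (□ T₂ P)
    □-commutes = comp-⇔⁻ B.𝒦 {T = M} {T₁} {T₂} {M} commutes

    -- The adjoint condition is applied to each `U` in `F A.𝒦 T₁ (□ M V)`; membership in this family
    -- is what its premise asks for.
    □M⋂F⊆ : {V : 𝒫 B.Carrier} → V ∈ S B.𝒦 →
            □ M (⋂ (F B.𝒦 T₂ V)) ⊆ ⋂ (F A.𝒦 T₁ (□ M V))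
    □M⋂F⊆ {V} V∈S {x} Mx⊆ U (U∈S , □V⊆□U) =
      proj₂ (adjoint U∈S V∈S
        (λ y My∈D → r₁.T∈𝒞 y , □V⊆□U (proj₂ My∈D))
        x
        (λ {W} W∈F → meet-∈𝒞 isMeetRelation x , λ Mxy → Mx⊆ Mxy W W∈F))
        (cl-refl A.𝒦)

    -- This half rests on commutation: the unit for `T₂` gives
    -- `□ M V ⊆ □ M (□ T₂ (⋂ (F B.𝒦 T₂ V)))`, and exchanging the boxes allows the transposition
    -- along `T₁`.
    ⋂F□M⊆ : {V : 𝒫 B.Carrier} → V ∈ S B.𝒦 →
            ⋂ (F A.𝒦 T₁ (□ M V)) ⊆ □ M (⋂ (F B.𝒦 T₂ V))
    ⋂F□M⊆ {V} V∈S =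
      ⋂F-least {𝒦 = A.𝒦} {T₁} {A = □ M V} (□-S′ □-S (r₂.⋂F-S V∈S))
        (λ My⊆V → proj₂ (□-commutes (r₂.⋂F-S V∈S))
          (λ Mxy → ⋂F-unit {𝒦 = B.𝒦} {T₂} V (My⊆V Mxy)))

relationOf-cong : {X Y : Set ℓ} (p : X ≡ Y) {𝒦 : Family X} {𝒦′ : Family Y}
                  {R : MultiRelation X} {R′ : MultiRelation Y} →
                  subst Family p 𝒦 ≐ 𝒦′ → subst MultiRelation p R ⇔ R′ →
                  subst (λ X → Relation X X) p (relationOf 𝒦 R) ⇔ relationOf 𝒦′ R′
relationOf-cong refl 𝒦≐ (R⇒ , R⇐) =
  (λ y∈ U (U∈S , meets) → y∈ U (S-cong (≐-sym 𝒦≐) U∈S , meets ∘ R⇒)) ,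
  (λ y∈ U (U∈S , meets) → y∈ U (S-cong 𝒦≐ U∈S , meets ∘ R⇐))

-- Resizing, and the compactness argument for filters.

module Classical (em : ∀ {a : Level} → ExcludedMiddle a) where

  -- Z ∈ 𝒵 𝒦 lives one universe above the values of a MultiRelation.
  Resize : Set a → Set b
  Resize P = Lift _ (True (em {P = P}))

  pack : {P : Set a} → P → Resize {b = b} P
  pack p = lift (fromWitness p)

  unpack : {P : Set a} → Resize {b = b} P → P
  unpack p = toWitness (lower p)

  -- Let `U` be the complement of the compact set `O`. Members of `𝒦` with complement in `𝓕` cover
  -- `O`, finitely many of them suffice, and directedness gives a member of `𝓕` disjoint from all of
  -- these, hence inside `U`.
  filter-closed : {X : Set ℓ} {𝒦 : Family X} → IsSSpace 𝒦 → {𝓕 : Family X} →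
    𝓕 ⊆ S 𝒦 → Satisfiable 𝓕 →
    (∀ {U V} → U ∈ 𝓕 → V ∈ 𝓕 → ∃[ W ] W ∈ 𝓕 × W ⊆ U × W ⊆ V) →
    (∀ {U V} → U ∈ 𝓕 → V ∈ S 𝒦 → U ⊆ V → V ∈ 𝓕) →
    ∀ {U} → U ∈ S 𝒦 → ⋂ 𝓕 ⊆ U → U ∈ 𝓕
  filter-closed {X = X} {𝒦} isSSpace {𝓕} 𝓕⊆S inhabited directed up
      {U} U∈S@(O , O∈𝒦 , U≐) ⋂⊆U =
    let Os , Os∈ , O⊆Os = S2-compact O∈𝒦 𝒰
          (λ (P∈𝒦 , _) x∈P → _ ∷ [] , P∈𝒦 ∷ [] , x∈P ∷ [] , head)
          cover
        V , V∈𝓕 , V-avoids = below Os∈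
    in up V∈𝓕 U∈S (λ x∈V → proj₂ U≐ (λ x∈O → V-avoids x∈V (O⊆Os x∈O)))
    where
    open IsSSpace isSSpace

    𝒰 : Family X
    𝒰 P = P ∈ 𝒦 × ∁ P ∈ 𝓕

    cover : ∀ {x} → x ∈ O → ∃[ P ] P ∈ 𝒰 × x ∈ P
    cover {x} x∈O = decidable-stable em λ uncovered →
      proj₁ U≐ (⋂⊆U (λ V V∈𝓕 →
        -- If `x` were uncovered it would lie in every `V` of `𝓕`, hence in `U`. Upward closure
        -- replaces `V` by the extensionally equal `∁ P`, the form that `𝒰` requires.
        let P , P∈𝒦 , V≐ = 𝓕⊆S V∈𝓕
        in proj₂ V≐ (λ x∈P → uncovered
             (P , (P∈𝒦 , up V∈𝓕 (P , P∈𝒦 , ≐-refl) (proj₁ V≐)) , x∈P)))) x∈O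

    below : ∀ {Os} → All (_∈ 𝒰) Os →
            ∃[ V ] V ∈ 𝓕 × (∀ {x} → x ∈ V → Any (x ∈_) Os → ⊥)
    below [] = proj₁ inhabited , proj₂ inhabited , λ _ ()
    below ((_ , ∁P∈𝓕) ∷ Os∈) =
      let V , V∈𝓕 , V-avoids = below Os∈
          W , W∈𝓕 , W⊆∁P , W⊆V = directed ∁P∈𝓕 V∈𝓕
      in W , W∈𝓕 , λ { x∈W (here x∈P) → ⊥-elim (W⊆∁P x∈W x∈P)
                      ; x∈W (there x∈Os) → V-avoids (W⊆V x∈W) x∈Os }

  -- Multirelations from monotone operators.

  module _ {X : Set ℓ} (𝒦 : Family X) where

    -- The right-hand side of `m2`, with `h` in place of `m 𝒦 R`.
    multirelationOf : (𝒫 X → Pred X b) → MultiRelation X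
    multirelationOf h x Z = Resize (Z ∈ 𝒵 𝒦 × (∀ U → U ∈ S 𝒦 → x ∈ h U → Z ≬ U))

    module _ {h : 𝒫 X → Pred X b}
             (h-mono : ∀ {U V} → U ∈ S 𝒦 → V ∈ S 𝒦 → U ⊆ V → h U ⊆ h V) where

      -- If x ∉ h U, then ∁ U is related to x: a V with x ∈ h V disjoint from ∁ U
      -- would be contained in U.
      m-multirelationOf : ∀ {U} → U ∈ S 𝒦 → m 𝒦 (multirelationOf h) U ≐ h U
      m-multirelationOf {U} U∈S@(O , O∈𝒦 , U≐) =
        (λ {x} x∈m → decidable-stable em λ x∉h →
          let _ , z , z∈O , z∈U = x∈m {O} (pack
                (O∈𝒵 , λ V V∈S x∈hV → decidable-stable em λ disjoint →
                  x∉h (h-mono V∈S U∈S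
                    (λ {v} v∈V → proj₂ U≐ (λ v∈O → disjoint (v , v∈O , v∈V))) x∈hV)))
          in proj₁ U≐ z∈U z∈O) ,
        (λ x∈h Z∈ → let Z∈𝒵 , meets = unpack Z∈ in Z∈𝒵 , meets U U∈S x∈h)
        where
        -- The one-member family containing `O` is dually directed and has intersection `O`.
        O∈𝒵 : O ∈ 𝒵 𝒦
        O∈𝒵 = (λ V → Lift (suc ℓ) (V ≡ O)) ,
              (λ { (lift refl) → O∈𝒦 }) ,
              (O , lift refl) ,
              (λ { (lift refl) (lift refl) → O , lift refl , id , id }) ,
              (λ { x∈O _ (lift refl) → x∈O }) ,
              (λ x∈ → x∈ O (lift refl))

      multirelationOf-isMSSpace : IsSSpace 𝒦 → (∀ {U} → U ∈ S 𝒦 → h U ∈ S 𝒦) →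
                                  IsMSSpace 𝒦 (multirelationOf h)
      multirelationOf-isMSSpace isSSpace h-S = record
        { isSSpace = isSSpace
        ; R⊆𝒵 = λ x Z∈ → proj₁ (unpack Z∈)
        ; m1  = λ U∈S → S-resp 𝒦 (≐-sym (m-multirelationOf U∈S)) (h-S U∈S)
        ; m2  = λ x →
            (λ Z∈ → proj₁ (unpack Z∈) , λ U U∈S x∈m → x∈m Z∈) ,
            (λ (Z∈𝒵 , meets) → pack (Z∈𝒵 , λ U U∈S x∈h →
              proj₂ (meets U U∈S (proj₂ (m-multirelationOf U∈S) x∈h))))
        }

    -- Uniqueness: by `m2` a multirelation is recovered from its operator `m 𝒦 R`.
    multirelationOf-m : {R : MultiRelation X} {h : 𝒫 X → Pred X b} → IsMSSpace 𝒦 R →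
      (∀ {U} → U ∈ S 𝒦 → h U ≐ m 𝒦 R U) → multirelationOf h ⇔ R
    multirelationOf-m isMS h≐m =
      (λ {x} Z∈ → let Z∈𝒵 , meets = unpack Z∈ in
        proj₂ (m2 x) (Z∈𝒵 , λ U U∈S x∈m → Z∈𝒵 , meets U U∈S (proj₂ (h≐m U∈S) x∈m))) ,
      (λ {x} Z∈R → pack (R⊆𝒵 x Z∈R , λ U U∈S x∈h →
        proj₂ (proj₂ (proj₁ (m2 x) Z∈R) U U∈S (proj₁ (h≐m U∈S) x∈h))))
      where
      open IsMSSpace isMS

    I-of E-of : Relation X X → MultiRelation X
    I-of T = multirelationOf (λ U → ⋂ (F 𝒦 T U))
    E-of T = multirelationOf (□ T)

  multirelationOf-cong : {X : Set ℓ} {𝒦 𝒦′ : Family X} {h h′ : 𝒫 X → Pred X b} →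
    𝒦 ≐ 𝒦′ → (∀ U → h U ≐ h′ U) → multirelationOf 𝒦 h ⇔ multirelationOf 𝒦′ h′
  multirelationOf-cong {𝒦 = 𝒦} {𝒦′} {h} {h′} 𝒦≐ h≐ =
    half 𝒦≐ (proj₂ ∘ h≐) , half (≐-sym 𝒦≐) (proj₁ ∘ h≐)
    where
    half : ∀ {𝒦 𝒦′ h h′} → 𝒦 ≐ 𝒦′ → (∀ U → h′ U ⊆ h U) →
           ∀ {x Z} → multirelationOf 𝒦 h x Z → multirelationOf 𝒦′ h′ x Z
    half 𝒦≐ h′⊆h Z∈ =
      let Z∈𝒵 , meets = unpack Z∈
      in pack (𝒵-cong 𝒦≐ Z∈𝒵 , λ U U∈S x∈h′ →
           meets U (S-cong (≐-sym 𝒦≐) U∈S) (h′⊆h U x∈h′))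

  I-of-cong : {X Y : Set ℓ} (p : X ≡ Y) {𝒦 : Family X} {𝒦′ : Family Y}
    {T : Relation X X} {T′ : Relation Y Y} →
    subst Family p 𝒦 ≐ 𝒦′ → subst (λ X → Relation X X) p T ⇔ T′ →
    subst MultiRelation p (I-of 𝒦 T) ⇔ I-of 𝒦′ T′
  I-of-cong refl 𝒦≐ (T⇒ , T⇐) = multirelationOf-cong 𝒦≐ λ U →
    (λ x∈ V (V∈S , U⊆□V) →
      x∈ V (S-cong (≐-sym 𝒦≐) V∈S , λ u∈U Tuv → U⊆□V u∈U (T⇒ Tuv))) ,
    (λ x∈ V (V∈S , U⊆□V) →
      x∈ V (S-cong 𝒦≐ V∈S , λ u∈U Tuv → U⊆□V u∈U (T⇐ Tuv)))

  E-of-cong : {X Y : Set ℓ} (p : X ≡ Y) {𝒦 : Family X} {𝒦′ : Family Y}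
    {T : Relation X X} {T′ : Relation Y Y} →
    subst Family p 𝒦 ≐ 𝒦′ → subst (λ X → Relation X X) p T ⇔ T′ →
    subst MultiRelation p (E-of 𝒦 T) ⇔ E-of 𝒦′ T′
  E-of-cong refl {T = T} {T′} 𝒦≐ (T⇒ , T⇐) =
    multirelationOf-cong {h = □ T} {□ T′} 𝒦≐ λ U →
      (λ Tx⊆U Txy → Tx⊆U (T⇐ Txy)) , (λ Tx⊆U Txy → Tx⊆U (T⇒ Txy))

  -- Translation of objects in both directions.

  module FromSLata (A : SLataSpace ℓ) where
    open SLata A

    T : Relation Carrier Carrier
    T = relationOf 𝒦 E

    corresponds : Corresponds 𝒦 I E T
    corresponds = record
      { □≐m  = □≐m
      -- Left adjoints are unique: the unit makes `m 𝒦 I U` an upper bound for the least solution,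
      -- and the counit puts it below every member of `F 𝒦 T U`.
      ; ⋂F≐m = λ {U} U∈S →
          ⋂F-least {𝒦 = 𝒦} {T} (I.m1 U∈S)
            (λ x∈U → proj₂ (□≐m-S 𝒦 □≐m (I.m1 U∈S)) (unit U∈S x∈U)) ,
          (λ x∈m V (V∈S , U⊆□V) →
            counit V∈S
              (m-mono I {Q = m 𝒦 E V} (λ u∈U → proj₁ (□≐m V∈S) (U⊆□V u∈U)) x∈m))
      }
      where
      □≐m : {U : 𝒫 Carrier} → U ∈ S 𝒦 → □ T U ≐ m 𝒦 E U
      □≐m U∈S =
        -- `T x` is the intersection of the filter `meetsOf 𝒦 E x`, so `T x ⊆ U` forces `U` into the
        -- filter.
        (λ {x} Tx⊆U → meetsOf-E⇒m (filter-closed I.isSSpace proj₁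
          (meetsOf-E-inhabited x) (meetsOf-E-directed x) (meetsOf-E-up x) U∈S Tx⊆U)) ,
        (λ x∈m Txy → Txy _ (m⇒meetsOf-E U∈S id x∈m))

    isARelation : IsARelation 𝒦 T
    isARelation = record
      { T∈𝒞  = λ x → ⋂-∈𝒞 𝒦 proj₁ ≐-refl
      ; □-S  = λ U∈S → S-resp 𝒦 (≐-sym (□≐m U∈S)) (E.m1 U∈S)
      ; ⋂F-S = λ U∈S → S-resp 𝒦 (≐-sym (⋂F≐m U∈S)) (I.m1 U∈S)
      }
      where
      open Corresponds corresponds

    relSSpace : RelSSpace ℓ
    relSSpace = record
      { 𝒦 = 𝒦 ; T = T ; isSSpace = I.isSSpace ; isARelation = isARelation }

  module FromRelS (B : RelSSpace ℓ) where
    open RelSSpace B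
    open IsARelation isARelation

    I E : MultiRelation Carrier
    I = I-of 𝒦 T
    E = E-of 𝒦 T

    corresponds : Corresponds 𝒦 I E T
    corresponds = record
      { □≐m  = λ U∈S → ≐-sym (m-multirelationOf 𝒦 (λ _ _ → □-mono T) U∈S)
      ; ⋂F≐m = λ U∈S → ≐-sym (m-multirelationOf 𝒦 (λ _ _ → ⋂F-mono {T = T}) U∈S)
      }

    open Corresponds corresponds

    slataSpace : SLataSpace ℓ
    slataSpace = record
      { 𝒦 = 𝒦
      ; I = I
      ; E = E
      ; A1-I = multirelationOf-isMSSpace 𝒦 (λ _ _ → ⋂F-mono {T = T}) isSSpace ⋂F-S
      ; A1-E = multirelationOf-isMSSpace 𝒦 (λ _ _ → □-mono T) isSSpace □-S
      -- A2 is the unit `U ⊆ □ T (⋂ (F 𝒦 T U))`, and A3 the counit `⋂ (F 𝒦 T (□ T U)) ⊆ U`, both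
      -- read through `corresponds`.
      ; A2 = λ {U} U∈S x∈U Z∈E →
          let _ , z , z∈Z , z∈⋂F = proj₁ (□≐m′ (⋂F-S U∈S))
                (⋂F-unit {𝒦 = 𝒦} {T} U x∈U) Z∈E
          in z , z∈Z , proj₁ (⋂F≐m U∈S) z∈⋂F
      ; A3 = λ {U} U∈S x∈ →
          ⋂F-least {𝒦 = 𝒦} {T} U∈S id (proj₂ (⋂F≐m′ (□-S U∈S)) (λ Z∈I →
            let y , y∈Z , Ey⊆ = x∈ Z∈I
            in proj₁ (unpack Z∈I) , y , y∈Z , proj₂ (□≐m U∈S) Ey⊆))
      }

  -- The functors and the isomorphism of categories.

  module _ (ℓ : Level) where
    private
      module L = StructureCategory (SLata-structures ℓ)
      module R = StructureCategory (RelS-structures ℓ)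

    to₀ : SLataSpace ℓ → RelSSpace ℓ
    to₀ A = FromSLata.relSSpace A

    from₀ : RelSSpace ℓ → SLataSpace ℓ
    from₀ B = FromRelS.slataSpace B

    -- Carrier, `𝒦` and graphs are kept, so identities and composites have the same graphs on both
    -- sides.
    toFunctor : Functor (SLataSp ℓ) (RelSP ℓ)
    toFunctor = record
      { F₀ = to₀
      ; F₁ = λ {A} {B} f → record
          { graph = L.graph f
          ; isMorphism = SLata⇒adjointPreserving {A = A} {B}
              (FromSLata.corresponds A) (FromSLata.corresponds B)
              (FromSLata.isARelation A) (FromSLata.isARelation B) (L.isMorphism f) }
      ; F₀-cong = to₀-cong
      ; F₁-cong = λ e → record
          { dom = to₀-cong (L.dom e) ; cod = to₀-cong (L.cod e)
          ; graph-⇔ = L.graph-⇔ e }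
      ; identity = record { dom = ≋-refl ; cod = ≋-refl ; graph-⇔ = id , id }
      ; homomorphism = record { dom = ≋-refl ; cod = ≋-refl ; graph-⇔ = id , id }
      }
      where
      open Category (RelSP ℓ) using (≋-refl)

      to₀-cong : ∀ {A B} → A ≋ᴸ B → to₀ A ≋ᴿ to₀ B
      to₀-cong {A} {B} e = record
        { carrier = carrier ; 𝒦-≐ = 𝒦-≐
        ; T-⇔ = relationOf-cong carrier {R = SLataSpace.E A} {SLataSpace.E B} 𝒦-≐ E-⇔ }
        where
        open _≋ᴸ_ e

    fromFunctor : Functor (RelSP ℓ) (SLataSp ℓ)
    fromFunctor = record
      { F₀ = from₀
      ; F₁ = λ {A} {B} f → record
          { graph = R.graph f
          ; isMorphism = adjointPreserving⇒SLata {A = from₀ A} {from₀ B}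
              (FromRelS.corresponds A) (FromRelS.corresponds B)
              (RelSSpace.isARelation A) (RelSSpace.isARelation B) (R.isMorphism f) }
      ; F₀-cong = from₀-cong
      ; F₁-cong = λ e → record
          { dom = from₀-cong (R.dom e) ; cod = from₀-cong (R.cod e)
          ; graph-⇔ = R.graph-⇔ e }
      ; identity = record { dom = ≋-refl ; cod = ≋-refl ; graph-⇔ = id , id }
      ; homomorphism = record { dom = ≋-refl ; cod = ≋-refl ; graph-⇔ = id , id }
      }
      where
      open Category (SLataSp ℓ) using (≋-refl)

      from₀-cong : ∀ {A B} → A ≋ᴿ B → from₀ A ≋ᴸ from₀ B
      from₀-cong {A} {B} e = record
        { carrier = carrier ; 𝒦-≐ = 𝒦-≐
        ; I-⇔ = I-of-cong carrier {T = RelSSpace.T A} {RelSSpace.T B} 𝒦-≐ T-⇔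
        ; E-⇔ = E-of-cong carrier {T = RelSSpace.T A} {RelSSpace.T B} 𝒦-≐ T-⇔ }
        where
        open _≋ᴿ_ e

    from∘to : ∀ A → from₀ (to₀ A) ≋ᴸ A
    from∘to A = record
      { carrier = refl ; 𝒦-≐ = ≐-refl
      ; I-⇔ = multirelationOf-m 𝒦 A1-I ⋂F≐m
      ; E-⇔ = multirelationOf-m 𝒦 A1-E □≐m }
      where
      open SLataSpace A
      open Corresponds (FromSLata.corresponds A)

    to∘from : ∀ B → to₀ (from₀ B) ≋ᴿ B
    to∘from B = record
      { carrier = refl ; 𝒦-≐ = ≐-refl
      ; T-⇔ =
          -- `T x` is the intersection of a family `𝒜` in `S 𝒦`; each `U` of `𝒜` contains `T x`, so
          -- `□≐m` puts it among the sets intersected by `relationOf`.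
          (λ {x} y∈ → let 𝒜 , 𝒜⊆S , Tx≐ = T∈𝒞 x in
            proj₂ Tx≐ (λ U U∈𝒜 → y∈ U (𝒜⊆S U∈𝒜 , λ Z∈E →
              proj₂ (proj₁ (□≐m (𝒜⊆S U∈𝒜)) (λ Txy → proj₁ Tx≐ Txy U U∈𝒜) Z∈E)))) ,
          (λ Txy U (U∈S , meets) →
            proj₂ (□≐m U∈S) (λ Z∈E → proj₁ (unpack Z∈E) , meets Z∈E) Txy) }
      where
      open RelSSpace B
      open IsARelation isARelation
      open Corresponds (FromRelS.corresponds B)

    SLataSp≅RelSP : SLataSp ℓ ≅ RelSP ℓ
    SLataSp≅RelSP = record
      { to   = toFunctor
      ; from = fromFunctor
      ; from∘to₀ = from∘to
      ; from∘to₁ = λ {A} {B} f → record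
          { dom = from∘to A ; cod = from∘to B ; graph-⇔ = id , id }
      ; to∘from₀ = to∘from
      ; to∘from₁ = λ {A} {B} f → record
          { dom = to∘from A ; cod = to∘from B ; graph-⇔ = id , id }
      }

theorem4p4 : (∀ {a : Level} → ExcludedMiddle a) →
    (ℓ : Level) → SLataSp ℓ ≅ RelSP ℓ
theorem4p4 em ℓ = Classical.SLataSp≅RelSP em ℓ
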